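{- For every integer $m\ge2$ and every graph $G$, $\hom(S_{2,1^0};G)\cdot\hom(S_{2,1^{m-2}};G)^2\ge \hom(S_{2,1^{m-1}};G)^2$.
   Context: All graphs are finite; $\hom(H;G)$ is the number of graph homomorphisms from $H$ to $G$. For $k\ge0$, $S_{2,1^k}$ is the tree with vertex set $\{1,\ldots,k+3\}$ and edge set $\{\{1,j\}:2\le j\le k+2\}\cup\{\{k+2,k+3\}\}$. -}

module Defs where

open import Data.Fin.Base using (Fin; toℕ)
open import Data.Fin.Properties using (all?)
open import Data.List.Base using (List; []; _∷_; allFin; cartesianProductWith; filter; length)
open import Data.List.Membership.Propositional using (_∈_)
open import Data.List.Membership.Propositional.Properties using (∈-allFin; ∈-cartesianProductWith⁺)
open import Data.List.Relation.Unary.All using ([])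
open import Data.List.Relation.Unary.AllPairs using ([]; _∷_)
open import Data.List.Relation.Unary.Any using (here)
open import Data.List.Relation.Unary.Unique.Propositional using (Unique)
open import Data.List.Relation.Unary.Unique.Propositional.Properties using (allFin⁺; cartesianProductWith⁺)
open import Data.Nat.Base using (ℕ; zero; suc; _+_; _≤_; s≤s)
open import Data.Nat.Properties using (_≟_; _≤?_; +-cancelˡ-≡)
open import Data.Product.Base using (_×_; _,_)
open import Data.Sum.Base using (_⊎_; inj₁; inj₂)
open import Data.Vec.Base as Vec using (Vec; lookup)
open import Data.Vec.Properties using (∷-injective)
open import Level using (0ℓ)
open import Relation.Binary.Construct.Closure.Symmetric using (SymClosure; fwd; bwd; symmetric)
open import Relation.Binary.Core using (Rel)
open import Relation.Binary.Definitions using (Decidable; Symmetric)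
open import Relation.Binary.PropositionalEquality using (_≡_; refl; sym; trans)
open import Relation.Nullary.Decidable using (Dec; yes; no; _×-dec_; _⊎-dec_; _→-dec_)
open import Relation.Nullary.Negation using (¬_)

-- Finite simple graphs. Adjacency is decidable so that homomorphisms can be
-- counted.
record Graph : Set₁ where
  field
    order       : ℕ
    Adj         : Rel (Fin order) 0ℓ
    Adj-sym     : Symmetric Adj
    Adj-irrefl  : ∀ v → ¬ Adj v v
    _Adj?_      : Decidable Adj

open Graph public

-- A map of vertex sets V(H) → V(G) is represented by its vector of values.
Map : Graph → Graph → Set
Map H G = Vec (Fin (order G)) (order H)

IsHom : (H G : Graph) → Map H G → Set
IsHom H G φ = ∀ u v → Adj H u v → Adj G (lookup φ u) (lookup φ v)

isHom? : (H G : Graph) (φ : Map H G) → Dec (IsHom H G φ)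
isHom? H G φ =
  all? λ u → all? λ v → _Adj?_ H u v →-dec _Adj?_ G (lookup φ u) (lookup φ v)

allVecs : (n k : ℕ) → List (Vec (Fin n) k)
allVecs n zero    = Vec.[] ∷ []
allVecs n (suc k) = cartesianProductWith Vec._∷_ (allFin n) (allVecs n k)

-- The next two facts say that each vector is listed exactly once.
allVecs-complete : ∀ {n k} (φ : Vec (Fin n) k) → φ ∈ allVecs n k
allVecs-complete Vec.[]      = here refl
allVecs-complete (x Vec.∷ φ) =
  ∈-cartesianProductWith⁺ Vec._∷_ (∈-allFin x) (allVecs-complete φ)

allVecs-unique : ∀ n k → Unique (allVecs n k)
allVecs-unique n zero    = [] ∷ []
allVecs-unique n (suc k) =
  cartesianProductWith⁺ Vec._∷_ ∷-injective (allFin⁺ n) (allVecs-unique n k)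

hom : Graph → Graph → ℕ
hom H G = length (filter (isHom? H G) (allVecs (order G) (order H)))

-- The elements of Fin (3 + k) carry the labels 1, …, k + 3.
label : ∀ {n} → Fin n → ℕ
label i = suc (toℕ i)

-- The edges {1, j} for 2 ≤ j ≤ k + 2 and {k + 2, k + 3}, each oriented from
-- its smaller label to its larger one.
SpiderEdge : (k : ℕ) → Rel (Fin (3 + k)) 0ℓ
SpiderEdge k a b =
    (label a ≡ 1 × 2 ≤ label b × label b ≤ k + 2)
  ⊎ (label a ≡ k + 2 × label b ≡ k + 3)

private
  spiderEdge? : ∀ k → Decidable (SpiderEdge k)
  spiderEdge? k a b =
          (label a ≟ 1 ×-dec 2 ≤? label b ×-dec label b ≤? k + 2)
    ⊎-dec (label a ≟ k + 2 ×-dec label b ≟ k + 3)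

  spiderEdge-irrefl : ∀ k v → ¬ SpiderEdge k v v
  spiderEdge-irrefl k v (inj₁ (p , q , _)) with toℕ v | p | q
  ... | zero | _ | s≤s ()
  spiderEdge-irrefl k v (inj₂ (p , q)) with () ← +-cancelˡ-≡ k 2 3 (trans (sym p) q)

  symClosure? : ∀ {A : Set} {R : Rel A 0ℓ} → Decidable R → Decidable (SymClosure R)
  symClosure? R? a b with R? a b | R? b a
  ... | yes r | _     = yes (fwd r)
  ... | no _  | yes r = yes (bwd r)
  ... | no ¬r | no ¬s = no λ { (fwd r) → ¬r r ; (bwd s) → ¬s s }

-- The tree S_{2,1^k}.
S₂₁ : ℕ → Graph
S₂₁ k = record
  { order      = 3 + k
  ; Adj        = SymClosure (SpiderEdge k)
  ; Adj-sym    = symmetric (SpiderEdge k)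
  ; Adj-irrefl = λ { v (fwd e) → spiderEdge-irrefl k v e
                   ; v (bwd e) → spiderEdge-irrefl k v e }
  ; _Adj?_     = symClosure? (spiderEdge? k)
  }

{-# OPTIONS --safe #-}
-- Let Δ be the maximum degree of G. Deleting a leaf adjacent to the centre of
-- S_{2,1^{k+1}} leaves S_{2,1^k}, and a homomorphism of the latter extends over
-- the leaf in at most Δ ways, so hom(S_{2,1^{k+1}}) ≤ Δ hom(S_{2,1^k}). On the
-- other hand S_{2,1^0} is the path with three vertices, and the homomorphisms
-- sending its midpoint to a vertex of degree Δ already number Δ².
module Submission where

open import Defs
open import Data.Nat.Base using (ℕ; _*_; _^_; _∸_; _≤_; _≥_)

open import Data.Nat.Properties
open import Algebra.Properties.CommutativeSemiring.Exp +-*-commutativeSemiring using (^-distrib-*)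
open import Data.Bool.Base using (true; false)
open import Data.Fin.Base using (Fin; zero; suc; punchIn)
open import Data.Fin.Properties using () renaming (_≟_ to _≟ᶠ_)
open import Data.List.Base
  using (List; []; _∷_; _++_; allFin; cartesianProductWith; filter; length; map)
open import Data.List.Extrema.Nat using (max; xs≤max; argmax-all)
open import Data.List.Membership.Propositional.Properties using (∈-allFin; ∈-map⁺)
open import Data.List.Properties using (filter-++; filter-none; filter-some; length-++)
open import Data.List.Relation.Unary.All using (lookup; universal)
open import Data.List.Relation.Unary.All.Properties using (map⁺)
open import Data.List.Relation.Unary.Any using () renaming (map to Any-map)
open import Data.Nat.Base using (zero; suc; _+_; z≤n; s≤s)
open import Data.Product.Base using (_×_; _,_; proj₁; proj₂)
open import Data.Sum.Base using (inj₁; inj₂)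
open import Data.Vec.Base as Vec using (Vec)
open import Data.Unit.Base using (tt)
open import Function.Base using (_∘_; id)
open import Level using (Level)
open import Relation.Binary.Construct.Closure.Symmetric using (fwd; bwd; gmap)
open import Relation.Binary.PropositionalEquality using (_≡_; refl; sym; trans; cong; subst₂)
open import Relation.Nullary.Decidable using (yes; no; does; _×-dec_)
open import Relation.Nullary.Negation using (contradiction)
open import Relation.Unary using (Pred; Decidable)

private
  variable
    a b c p q r : Level
    A : Set a
    B : Set b
    C : Set c

-- `hom H G` unfolds to a `count` over `allVecs`, so the lemmas on `count` apply to it without
-- conversion. `allVecs` is built by `cartesianProductWith`, so peeling off one entry of a map is
-- slicing a product.
count : {P : Pred A p} → Decidable P → List A → ℕ
count P? xs = length (filter P? xs)

count-map : {P : Pred B p} (P? : Decidable P) (f : A → B) (xs : List A) →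
            count P? (map f xs) ≡ count (P? ∘ f) xs
count-map P? f []       = refl
count-map P? f (x ∷ xs) with does (P? (f x))
... | true  = cong suc (count-map P? f xs)
... | false = count-map P? f xs

count-mono : {P : Pred A p} {Q : Pred A q} (P? : Decidable P) (Q? : Decidable Q) →
             (∀ {x} → P x → Q x) → ∀ xs → count P? xs ≤ count Q? xs
count-mono P? Q? P⊆Q []       = z≤n
count-mono P? Q? P⊆Q (x ∷ xs) with P? x | Q? x
... | yes _  | yes _  = s≤s (count-mono P? Q? P⊆Q xs)
... | yes Px | no ¬Qx = contradiction (P⊆Q Px) ¬Qx
... | no _   | yes _  = m≤n⇒m≤1+n (count-mono P? Q? P⊆Q xs)
... | no _   | no _   = count-mono P? Q? P⊆Q xs

module _ {R : Pred C r} (R? : Decidable R) (f : A → B → C) where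

  count-cartesianProductWith-∷ : ∀ x xs ys →
    count R? (cartesianProductWith f (x ∷ xs) ys) ≡
    count (R? ∘ f x) ys + count R? (cartesianProductWith f xs ys)
  count-cartesianProductWith-∷ x xs ys = begin-equality
    count R? (map (f x) ys ++ rest)                ≡⟨ cong length (filter-++ R? (map (f x) ys) rest) ⟩
    length (filter R? (map (f x) ys) ++ filter R? rest)
                                                   ≡⟨ length-++ (filter R? (map (f x) ys)) ⟩
    count R? (map (f x) ys) + count R? rest        ≡⟨ cong (_+ count R? rest) (count-map R? (f x) ys) ⟩
    count (R? ∘ f x) ys + count R? rest            ∎
    where
    open ≤-Reasoning
    rest = cartesianProductWith f xs ys

  module _ {P : Pred A p} {Q : Pred B q} (P? : Decidable P) (Q? : Decidable Q) where

    -- Each `x` in `P` contributes a slice containing all of `Q`; the other slices are bounded below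
    -- by 0.
    count-×-≤ : (∀ {x y} → P x → Q y → R (f x y)) → ∀ xs ys →
                count P? xs * count Q? ys ≤ count R? (cartesianProductWith f xs ys)
    count-×-≤ PQ⇒R []       ys = z≤n
    count-×-≤ PQ⇒R (x ∷ xs) ys rewrite count-cartesianProductWith-∷ x xs ys with P? x
    ... | yes Px = +-mono-≤ (count-mono Q? (R? ∘ f x) (PQ⇒R Px) ys) (count-×-≤ PQ⇒R xs ys)
    ... | no _   = m≤n⇒m≤o+n _ (count-×-≤ PQ⇒R xs ys)

    -- Slices over `x` outside `P` are empty, and every other slice lies in `Q`.
    count-×-≥ : (∀ {x y} → R (f x y) → P x × Q y) → ∀ xs ys →
                count R? (cartesianProductWith f xs ys) ≤ count P? xs * count Q? ys
    count-×-≥ R⇒PQ []       ys = z≤n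
    count-×-≥ R⇒PQ (x ∷ xs) ys rewrite count-cartesianProductWith-∷ x xs ys with P? x
    ... | yes _  = +-mono-≤ (count-mono (R? ∘ f x) Q? (proj₂ ∘ R⇒PQ) ys) (count-×-≥ R⇒PQ xs ys)
    ... | no ¬Px = +-mono-≤
      (≤-reflexive (cong length (filter-none (R? ∘ f x) (universal (λ _ → ¬Px ∘ proj₁ ∘ R⇒PQ) ys))))
      (count-×-≥ R⇒PQ xs ys)

-- Used with the shared first coordinate as the image of the centre, on which the number of
-- extensions over a leaf depends; `m` bounds that number uniformly.
count-cartesianProductWith-≤ :
  ∀ {d e} {D : Set d} {E : Set e} {P : Pred C p} {Q : Pred E q}
  (P? : Decidable P) (Q? : Decidable Q) (f : A → B → C) (g : A → D → E) m ys zs →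
  (∀ x → count (P? ∘ f x) ys ≤ m * count (Q? ∘ g x) zs) → ∀ xs →
  count P? (cartesianProductWith f xs ys) ≤ m * count Q? (cartesianProductWith g xs zs)
count-cartesianProductWith-≤ P? Q? f g m ys zs slice []       = z≤n
count-cartesianProductWith-≤ P? Q? f g m ys zs slice (x ∷ xs)
  rewrite count-cartesianProductWith-∷ P? f x xs ys
        | count-cartesianProductWith-∷ Q? g x xs zs
        | *-distribˡ-+ m (count (Q? ∘ g x) zs) (count Q? (cartesianProductWith g xs zs))
  = +-mono-≤ (slice x) (count-cartesianProductWith-≤ P? Q? f g m ys zs slice xs)

-- S_{2,1^{k+1}} without vertex 2 is S_{2,1^k}.
SpiderEdge-punchIn : ∀ k {u v} → SpiderEdge k u v →
                     SpiderEdge (suc k) (punchIn (suc zero) u) (punchIn (suc zero) v)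
SpiderEdge-punchIn k {zero}  {suc v} (inj₁ (_ , _ , v≤k+2)) = inj₁ (refl , s≤s (s≤s z≤n) , s≤s v≤k+2)
SpiderEdge-punchIn k {zero}          (inj₂ (1≡k+2 , _))     = contradiction (trans 1≡k+2 (+-comm k 2)) λ ()
SpiderEdge-punchIn k {suc u} {suc v} (inj₂ (u≡k+2 , v≡k+3)) = inj₂ (cong suc u≡k+2 , cong suc v≡k+3)
SpiderEdge-punchIn k {suc u} {zero}  (inj₂ (_ , 1≡k+3))     = contradiction (trans 1≡k+3 (+-comm k 3)) λ ()
SpiderEdge-punchIn k {zero}  {zero}  (inj₁ (_ , s≤s () , _))

module _ (G : Graph) where

  private
    n = order G

  degree : Fin n → ℕ
  degree v = count (_Adj?_ G v) (allFin n)

  maxDegree : ℕ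
  -- The default 0 is the value for the graph without vertices and changes nothing otherwise.
  maxDegree = max 0 (map degree (allFin n))

  degree≤maxDegree : ∀ v → degree v ≤ maxDegree
  degree≤maxDegree v = lookup (xs≤max 0 (map degree (allFin n))) (∈-map⁺ degree (∈-allFin v))

  -- The entry `y` is the image of vertex 2, a leaf at the centre. The edge {1, 2} gives the
  -- adjacency, and precomposition with the embedding that skips vertex 2 gives the restriction.
  S₂₁-restrict : ∀ k {x y} {φ : Vec (Fin n) (2 + k)} →
                 IsHom (S₂₁ (suc k)) G (x Vec.∷ y Vec.∷ φ) →
                 Adj G x y × IsHom (S₂₁ k) G (x Vec.∷ φ)
  S₂₁-restrict k {x} {y} {φ} h =
    h zero (suc zero) (fwd (inj₁ (refl , s≤s (s≤s z≤n) , s≤s (m≤n⇒m≤o+n k (s≤s z≤n))))) , restricted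
    where
    lookup-punchIn : ∀ u → Vec.lookup (x Vec.∷ y Vec.∷ φ) (punchIn (suc zero) u) ≡
                           Vec.lookup (x Vec.∷ φ) u
    lookup-punchIn zero    = refl
    lookup-punchIn (suc u) = refl

    restricted : IsHom (S₂₁ k) G (x Vec.∷ φ)
    restricted u v uv = subst₂ (Adj G) (lookup-punchIn u) (lookup-punchIn v)
      (h _ _ (gmap (punchIn (suc zero)) (SpiderEdge-punchIn k) uv))

  hom-S₂₁-suc : ∀ k → hom (S₂₁ (suc k)) G ≤ maxDegree * hom (S₂₁ k) G
  hom-S₂₁-suc k =
    count-cartesianProductWith-≤ (isHom? (S₂₁ (suc k)) G) (isHom? (S₂₁ k) G)
      Vec._∷_ Vec._∷_ maxDegree (allVecs n (3 + k)) (allVecs n (2 + k)) slice (allFin n)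
    where
    slice : ∀ x → count (isHom? (S₂₁ (suc k)) G ∘ (x Vec.∷_)) (allVecs n (3 + k)) ≤
                  maxDegree * count (isHom? (S₂₁ k) G ∘ (x Vec.∷_)) (allVecs n (2 + k))
    -- With the centre sent to `x`, the leaf has at most `degree x` images, whatever the rest of the
    -- map is.
    slice x = ≤-trans
      (count-×-≥ (isHom? (S₂₁ (suc k)) G ∘ (x Vec.∷_)) Vec._∷_
        (_Adj?_ G x) (isHom? (S₂₁ k) G ∘ (x Vec.∷_))
        (S₂₁-restrict k) (allFin n) (allVecs n (2 + k)))
      (*-monoˡ-≤ _ (degree≤maxDegree x))

  -- For `k = 0` the edges are {1, 2} and {2, 3}, so vertex 1 is an end of the path and the midpoint
  -- is vertex 2, sent to `y`.
  S₂₁0-isHom : ∀ {x y z} → Adj G y x → Adj G y z →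
               IsHom (S₂₁ 0) G (x Vec.∷ y Vec.∷ z Vec.∷ Vec.[])
  S₂₁0-isHom {x} {y} {z} yx yz u v = λ { (fwd e) → along u v e ; (bwd e) → Adj-sym G (along v u e) }
    where
    φ = x Vec.∷ y Vec.∷ z Vec.∷ Vec.[]

    along : ∀ u v → SpiderEdge 0 u v → Adj G (Vec.lookup φ u) (Vec.lookup φ v)
    along zero          (suc zero)       _ = Adj-sym G yx
    along (suc zero)    (suc (suc zero)) _ = yz
    along zero          zero             (inj₁ (_ , s≤s () , _))
    along zero          (suc (suc zero)) (inj₁ (_ , _ , s≤s (s≤s ())))
    along (suc _)       _                (inj₁ (() , _))
    along (suc _)       zero             (inj₂ (_ , ()))
    along (suc _)       (suc zero)       (inj₂ (_ , ()))
    along (suc (suc _)) (suc (suc zero)) (inj₂ (() , _))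

  -- Once the midpoint is sent to `v`, both ends range independently over the neighbours of `v`.
  degree²≤hom-S₂₁0 : ∀ v → degree v ^ 2 ≤ hom (S₂₁ 0) G
  degree²≤hom-S₂₁0 v = begin
    degree v ^ 2                                  ≡⟨ cong (degree v *_) (*-identityʳ (degree v)) ⟩
    degree v * degree v                           ≤⟨ *-monoʳ-≤ (degree v) rays ⟩
    degree v * count viaV? (allVecs n 2)          ≤⟨ count-×-≤ (isHom? (S₂₁ 0) G) Vec._∷_ (_Adj?_ G v) viaV? glue (allFin n) (allVecs n 2) ⟩
    hom (S₂₁ 0) G                                 ∎
    where
    open ≤-Reasoning

    -- Pinning the midpoint to `v` makes the condition on the last two entries independent of the
    -- first, as a product bound requires.
    viaV? : Decidable {A = Vec (Fin n) 2} λ φ → Vec.head φ ≡ v × Adj G v (Vec.last φ)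
    viaV? φ = (Vec.head φ ≟ᶠ v) ×-dec _Adj?_ G v (Vec.last φ)

    glue : ∀ {x} {φ : Vec (Fin n) 2} → Adj G v x → Vec.head φ ≡ v × Adj G v (Vec.last φ) →
           IsHom (S₂₁ 0) G (x Vec.∷ φ)
    glue {φ = _ Vec.∷ _ Vec.∷ Vec.[]} vx (refl , vz) = S₂₁0-isHom vx vz

    rays : degree v ≤ count viaV? (allVecs n 2)
    rays = begin
      degree v                                    ≡⟨ *-identityʳ (degree v) ⟨
      -- The factor 1 counts the empty vector, the only element of `allVecs n 0`.
      degree v * 1                                ≤⟨ count-×-≤ (λ φ → _Adj?_ G v (Vec.head φ)) Vec._∷_ (_Adj?_ G v) (λ _ → yes tt) (λ vz _ → vz) (allFin n) (allVecs n 0) ⟩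
      ends                                        ≡⟨ *-identityˡ ends ⟨
      -- Here 1 bounds from below the number of choices for the midpoint, since `v` occurs in
      -- `allFin n`.
      1 * ends                                    ≤⟨ *-monoˡ-≤ ends (filter-some (_≟ᶠ v) (Any-map sym (∈-allFin v))) ⟩
      count (_≟ᶠ v) (allFin n) * ends             ≤⟨ count-×-≤ viaV? Vec._∷_ (_≟ᶠ v) (λ φ → _Adj?_ G v (Vec.head φ)) (λ { {y = _ Vec.∷ Vec.[]} y≡v vz → y≡v , vz }) (allFin n) (allVecs n 1) ⟩
      count viaV? (allVecs n 2)                   ∎
      where ends = count (λ φ → _Adj?_ G v (Vec.head φ)) (allVecs n 1)

  -- The maximum is either the default 0 or some degree, so it suffices to check the bound on both;
  -- no vertex attaining it has to be chosen.
  maxDegree²≤hom-S₂₁0 : maxDegree ^ 2 ≤ hom (S₂₁ 0) G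
  maxDegree²≤hom-S₂₁0 =
    argmax-all id {P = λ d → d ^ 2 ≤ hom (S₂₁ 0) G} {xs = map degree (allFin n)} z≤n
      (map⁺ (universal degree²≤hom-S₂₁0 (allFin n)))

theorem3p3 : (m : ℕ) → 2 ≤ m → (G : Graph) →
    hom (S₂₁ 0) G * hom (S₂₁ (m ∸ 2)) G ^ 2 ≥ hom (S₂₁ (m ∸ 1)) G ^ 2
-- With `m = k + 2` the truncated subtractions compute to `k` and `k + 1`.
theorem3p3 (suc (suc k)) (s≤s (s≤s z≤n)) G = begin
  hom (S₂₁ (suc k)) G ^ 2                    ≤⟨ ^-monoˡ-≤ 2 (hom-S₂₁-suc G k) ⟩
  (maxDegree G * hom (S₂₁ k) G) ^ 2          ≡⟨ ^-distrib-* (maxDegree G) (hom (S₂₁ k) G) 2 ⟩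
  maxDegree G ^ 2 * hom (S₂₁ k) G ^ 2        ≤⟨ *-monoˡ-≤ _ (maxDegree²≤hom-S₂₁0 G) ⟩
  hom (S₂₁ 0) G * hom (S₂₁ k) G ^ 2          ∎
  where open ≤-Reasoning
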